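{- Let $G_1=C(T_1,\ldots,T_{g_1})$ and $G_2=C(T'_1,\ldots,T'_{g_2})$ be unicyclic graphs, each of which has a perfect matching and each of which has Laplacian eigenvalue $2$, and let $G=G_1\odot G_2$ be a bicyclic graph obtained as a one-edge connection of $G_1$ and $G_2$. Let $s_1$ be the number of trees among $T_1,\ldots,T_{g_1}$ that have odd order, and let $s_2$ be the number of trees among $T'_1,\ldots,T'_{g_2}$ that have odd order. Then $s_1\equiv s_2\equiv 0\pmod 4$ if and only if $2$ is an eigenvalue of the Laplacian matrix $L(G)$.
   Context: All graphs are finite, undirected, with no loops or multiple edges. The Laplacian matrix of $G$ is $L(G)=D(G)-A(G)$, where $D(G)$ is the diagonal matrix of vertex degrees and $A(G)$ is the adjacency matrix; the Laplacian eigenvalues of $G$ are the eigenvalues of $L(G)$. A unicyclic graph is a connected graph whose number of edges equals its number of vertices; it consists of a cycle $C_g$ with vertices $v_1,\ldots,v_g$ and, for each $i$, a rooted tree $T_i$ of order $n_i\ge 1$ with root $v_i$, where $V(T_i)\cap V(C_g)=\{v_i\}$. Such a graph is denoted by $C(T_1,\ldots,T_g)$. A one-edge connection $G_1\odot G_2$ of two (vertex-disjoint) graphs $G_1,G_2$ is any graph $G$ with $V(G)=V(G_1)\cup V(G_2)$ and $E(G)=E(G_1)\cup E(G_2)\cup\{uv\}$ for some $u\in V(G_1)$ and $v\in V(G_2)$. A one-edge connection of two unicyclic graphs is a bicyclic graph. -}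

module Defs where

import Algebra.Properties.CommutativeMonoid.Sum as Sum
open import Data.Bool.Base using (if_then_else_)
open import Data.Fin.Base using (Fin; zero; suc; toℕ) renaming (_<_ to _<ᶠ_)
open import Data.Fin.Properties using (+↔⊎)
  renaming (_≟_ to _≟ᶠ_; _<?_ to _<ᶠ?_)
open import Data.Integer.Base using (+_)
open import Data.Nat.Base using (ℕ; zero; suc; _+_; _≤_; s≤s; _%_)
open import Data.Nat.Properties using (_≟_; +-0-commutativeMonoid)
open import Data.Product using (Σ; Σ-syntax; ∃-syntax; ∃!; _×_; _,_)
open import Data.Rational.Base using (ℚ; 0ℚ; 1ℚ; _-_; _*_)
open import Data.Rational.Literals using (fromℤ)
open import Data.Rational.Properties using ()
  renaming (+-0-commutativeMonoid to ℚ-+-0-commutativeMonoid)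
open import Data.Sum.Base using (_⊎_; inj₁; inj₂; swap)
open import Data.Sum.Function.Propositional using (_⊎-↔_)
open import Data.Vec.Functional using (Vector)
open import Function.Base using (_∘_)
open import Function.Bundles using (_↔_; _⇔_; mk↔ₛ′; module Inverse)
open import Function.Definitions using (Injective)
open import Function.Properties.Inverse using (↔-sym; ↔-trans; ↔⇒↣)
open import Level using (0ℓ)
open import Relation.Binary.Construct.Closure.ReflexiveTransitive using (Star)
open import Relation.Binary.Core using (Rel)
open import Relation.Binary.Definitions
  using (Decidable; DecidableEquality; Symmetric; Irreflexive)
open import Relation.Binary.PropositionalEquality.Core using (_≡_; refl; sym; trans; cong)
open import Relation.Nullary.Decidable
  using (yes; no; does; map′; via-injection; _×-dec_; _⊎-dec_)
open import Relation.Nullary.Negation using (¬_)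
import Relation.Unary as U

open Sum +-0-commutativeMonoid using () renaming (sum to sumℕ)
open Sum ℚ-+-0-commutativeMonoid using () renaming (sum to sumℚ)

count : ∀ {n} {P : Fin n → Set} → U.Decidable P → ℕ
count P? = sumℕ λ i → if does (P? i) then 1 else 0

Matrix : ℕ → Set
Matrix n = Fin n → Fin n → ℚ

_·_ : ∀ {n} → Matrix n → Vector ℚ n → Vector ℚ n
(M · x) i = sumℚ λ j → M i j * x j

-- For a rational matrix and a rational scalar, a nonzero eigenvector exists
-- over ℚ exactly when one exists over ℝ or ℂ.
HasEigenvalue : ∀ {n} → Matrix n → ℚ → Set
HasEigenvalue {n} M c =
  ∃[ x ] ¬ (∀ i → x i ≡ 0ℚ) × (∀ i → (M · x) i ≡ c * x i)

fromℕ : ℕ → ℚ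
fromℕ n = fromℤ (+ n)

record Graph : Set₁ where
  field
    V          : Set
    order      : ℕ
    enum       : Fin order ↔ V
    Adj        : Rel V 0ℓ
    Adj?       : Decidable Adj
    Adj-sym    : Symmetric Adj
    Adj-irrefl : Irreflexive _≡_ Adj

  vertex : Fin order → V
  vertex = Inverse.to enum

  _≟ⱽ_ : DecidableEquality V
  _≟ⱽ_ = via-injection (↔⇒↣ (↔-sym enum)) _≟ᶠ_

  size : ℕ
  size = sumℕ λ i → count λ j → (i <ᶠ? j) ×-dec Adj? (vertex i) (vertex j)

  degree : V → ℕ
  degree v = count λ j → Adj? v (vertex j)

  Connected : Set
  Connected = V × (∀ u v → Star Adj u v)

open Graph public using (V; order; size; Connected)

record _≅_ (G H : Graph) : Set where
  private
    module G = Graph G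
    module H = Graph H
  field
    bijection : G.V ↔ H.V
    Adj-⇔     : ∀ {u v} → G.Adj u v ⇔
                H.Adj (Inverse.to bijection u) (Inverse.to bijection v)

infix 4 _≅_

adjacencyMatrix : (G : Graph) → Matrix (order G)
adjacencyMatrix G i j = if does (Adj? (vertex i) (vertex j)) then 1ℚ else 0ℚ
  where open Graph G

degreeMatrix : (G : Graph) → Matrix (order G)
degreeMatrix G i j = if does (i ≟ᶠ j) then fromℕ (degree (vertex i)) else 0ℚ
  where open Graph G

laplacian : (G : Graph) → Matrix (order G)
laplacian G i j = degreeMatrix G i j - adjacencyMatrix G i j

HasPerfectMatching : Graph → Set₁
HasPerfectMatching G =
  Σ[ M ∈ Rel G.V 0ℓ ]
    (∀ {u v} → M u v → G.Adj u v) × Symmetric M × (∀ u → ∃! _≡_ (M u))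
  where module G = Graph G

Unicyclic : Graph → Set
Unicyclic G = Connected G × size G ≡ order G

-- j is the successor of i modulo g.
Next : ∀ {g} → Rel (Fin g) 0ℓ
Next {g} i j = (toℕ j ≡ suc (toℕ i)) ⊎ (suc (toℕ i) ≡ g × toℕ j ≡ 0)

CycAdj : ∀ {g} → Rel (Fin g) 0ℓ
CycAdj i j = Next i j ⊎ Next j i

Next? : ∀ {g} → Decidable (Next {g})
Next? {g} i j =
  (toℕ j ≟ suc (toℕ i)) ⊎-dec ((suc (toℕ i) ≟ g) ×-dec (toℕ j ≟ 0))

CycAdj? : ∀ {g} → Decidable (CycAdj {g})
CycAdj? i j = Next? i j ⊎-dec Next? j i

Next-irrefl : ∀ {g} → 3 ≤ g → (i : Fin g) → ¬ Next i i
Next-irrefl _ i (inj₁ e) = n≢1+n e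
  where
  n≢1+n : ∀ {n} → ¬ (n ≡ suc n)
  n≢1+n ()
Next-irrefl 3≤g i (inj₂ (e , z)) = absurd 3≤g (trans (cong suc (sym z)) e)
  where
  absurd : ∀ {g} → 3 ≤ g → ¬ (1 ≡ g)
  absurd (s≤s ()) refl

CycAdj-irrefl : ∀ {g} → 3 ≤ g → (i : Fin g) → ¬ CycAdj i i
CycAdj-irrefl 3≤g i (inj₁ n) = Next-irrefl 3≤g i n
CycAdj-irrefl 3≤g i (inj₂ n) = Next-irrefl 3≤g i n

record CycleIn (G : Graph) (k : ℕ) : Set where
  field
    3≤k       : 3 ≤ k
    cyc       : Fin k → V G
    injective : Injective _≡_ _≡_ cyc
    adjacent  : ∀ {i j} → Next i j → Graph.Adj G (cyc i) (cyc j)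

IsTree : Graph → Set
IsTree G = Connected G × (∀ k → ¬ CycleIn G k)

record RootedTree : Set₁ where
  field
    graph  : Graph
    isTree : IsTree graph
    root   : V graph

  open Graph graph public

Σ-enum : ∀ {g} {A : Fin g → Set} {n : Fin g → ℕ} →
         (∀ i → Fin (n i) ↔ A i) → Fin (sumℕ n) ↔ Σ (Fin g) A
Σ-enum {zero}  e = mk↔ₛ′ (λ ()) (λ ()) (λ ()) (λ ())
Σ-enum {suc g} {A} e =
  ↔-trans +↔⊎ (↔-trans (e zero ⊎-↔ Σ-enum (e ∘ suc)) split)
  where
  split : (A zero ⊎ Σ (Fin g) (A ∘ suc)) ↔ Σ (Fin (suc g)) A
  split = mk↔ₛ′
    (λ { (inj₁ a) → zero , a ; (inj₂ (i , a)) → suc i , a })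
    (λ { (zero , a) → inj₁ a ; (suc i , a) → inj₂ (i , a) })
    (λ { (zero , a) → refl ; (suc i , a) → refl })
    (λ { (inj₁ a) → refl ; (inj₂ (i , a)) → refl })

module _ {g : ℕ} (3≤g : 3 ≤ g) (T : Fin g → RootedTree) where
  private module T i = RootedTree (T i)

  data CAdj : Rel (Σ (Fin g) T.V) 0ℓ where
    treeEdge  : ∀ {i x y} → T.Adj i x y → CAdj (i , x) (i , y)
    cycleEdge : ∀ {i j} → CycAdj i j → CAdj (i , T.root i) (j , T.root j)

  CAdj? : Decidable CAdj
  CAdj? (i , x) (j , y) with i ≟ᶠ j
  ... | yes refl = map′ treeEdge inTree (T.Adj? i x y)
    where
    inTree : CAdj (i , x) (i , y) → T.Adj i x y
    inTree (treeEdge e) = e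
    inTree (cycleEdge c) with () ← CycAdj-irrefl 3≤g i c
  ... | no i≢j =
    map′ (λ { (c , refl , refl) → cycleEdge c }) onCycle
         (CycAdj? i j ×-dec (T._≟ⱽ_ i x (T.root i) ×-dec T._≟ⱽ_ j y (T.root j)))
    where
    onCycle : CAdj (i , x) (j , y) → CycAdj i j × x ≡ T.root i × y ≡ T.root j
    onCycle (treeEdge _) with () ← i≢j refl
    onCycle (cycleEdge c) = c , refl , refl

  CAdj-sym : Symmetric CAdj
  CAdj-sym (treeEdge {i} e) = treeEdge (T.Adj-sym i e)
  CAdj-sym (cycleEdge c)    = cycleEdge (swap c)

  CAdj-irrefl : Irreflexive _≡_ CAdj
  CAdj-irrefl refl (treeEdge {i} e)  = T.Adj-irrefl i refl e
  CAdj-irrefl refl (cycleEdge {i} c) = CycAdj-irrefl 3≤g i c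

  -- The graph C(T₁,…,T_g): the disjoint union of the trees, with the edges of
  -- the cycle C_g added on their roots.
  C : Graph
  C = record
    { V          = Σ (Fin g) T.V
    ; order      = sumℕ T.order
    ; enum       = Σ-enum T.enum
    ; Adj        = CAdj
    ; Adj?       = CAdj?
    ; Adj-sym    = CAdj-sym
    ; Adj-irrefl = CAdj-irrefl
    }

#oddTrees : ∀ {g} → (Fin g → RootedTree) → ℕ
#oddTrees T = count λ i → (RootedTree.order (T i) % 2) ≟ 1

module _ (G₁ G₂ : Graph) (u : V G₁) (v : V G₂) where
  private
    module G₁ = Graph G₁
    module G₂ = Graph G₂

  data ⊙Adj : Rel (G₁.V ⊎ G₂.V) 0ℓ where
    left    : ∀ {x y} → G₁.Adj x y → ⊙Adj (inj₁ x) (inj₁ y)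
    right   : ∀ {x y} → G₂.Adj x y → ⊙Adj (inj₂ x) (inj₂ y)
    bridge  : ⊙Adj (inj₁ u) (inj₂ v)
    bridge′ : ⊙Adj (inj₂ v) (inj₁ u)

  ⊙Adj? : Decidable ⊙Adj
  ⊙Adj? (inj₁ x) (inj₁ y) = map′ left (λ { (left e) → e }) (G₁.Adj? x y)
  ⊙Adj? (inj₂ x) (inj₂ y) = map′ right (λ { (right e) → e }) (G₂.Adj? x y)
  ⊙Adj? (inj₁ x) (inj₂ y) =
    map′ (λ { (refl , refl) → bridge }) (λ { bridge → refl , refl })
         ((x G₁.≟ⱽ u) ×-dec (y G₂.≟ⱽ v))
  ⊙Adj? (inj₂ y) (inj₁ x) =
    map′ (λ { (refl , refl) → bridge′ }) (λ { bridge′ → refl , refl })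
         ((x G₁.≟ⱽ u) ×-dec (y G₂.≟ⱽ v))

  ⊙Adj-sym : Symmetric ⊙Adj
  ⊙Adj-sym (left e)  = left (G₁.Adj-sym e)
  ⊙Adj-sym (right e) = right (G₂.Adj-sym e)
  ⊙Adj-sym bridge    = bridge′
  ⊙Adj-sym bridge′   = bridge

  ⊙Adj-irrefl : Irreflexive _≡_ ⊙Adj
  ⊙Adj-irrefl refl (left e)  = G₁.Adj-irrefl refl e
  ⊙Adj-irrefl refl (right e) = G₂.Adj-irrefl refl e

  oneEdgeConnection : Graph
  oneEdgeConnection = record
    { V          = G₁.V ⊎ G₂.V
    ; order      = G₁.order + G₂.order
    ; enum       = ↔-trans +↔⊎ (G₁.enum ⊎-↔ G₂.enum)
    ; Adj        = ⊙Adj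
    ; Adj?       = ⊙Adj?
    ; Adj-sym    = ⊙Adj-sym
    ; Adj-irrefl = ⊙Adj-irrefl
    }

module Submission where

-- Let M be a perfect matching. A vector that changes sign along the edges of M
-- and is constant along all other edges is a 2-eigenvector. On a tree such a
-- vector always exists; on a unicyclic graph it exists iff the cycle contains an
-- even number k of edges of M. The root vᵢ is matched along the cycle exactly
-- when Tᵢ has odd order, so s = 2k, and k is even iff 4 ∣ s.
--
-- Conversely, stripping leaves shows that a 2-eigenvector of C(T₁,…,T_g) follows
-- this sign rule on all tree edges. On the cycle, the defects of the sign rule
-- then satisfy the sign rule themselves. If k is odd, going once around the
-- cycle negates both, so the defects vanish, and then so does the vector. Hence
-- the hypotheses on G₁ and G₂ alone force s₁ ≡ s₂ ≡ 0 (mod 4), and then the two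
-- sign vectors, suitably scaled, glue along the bridge to a 2-eigenvector of G.

open import Defs
open import Algebra.Bundles using (CommutativeMonoid; CommutativeRing)
import Algebra.Properties.CommutativeMonoid.Sum as Sum
open import Data.Bool.Base using (if_then_else_; true; false)
open import Data.Fin.Base using (Fin; zero; suc; toℕ; inject₁) renaming (fromℕ to top)
open import Data.Fin.Permutation using (permutation)
open import Data.Fin.Properties
  using (suc-injective; toℕ-injective; toℕ-fromℕ; toℕ-inject₁; toℕ<n; <-cmp)
  renaming (_≟_ to _≟ᶠ_; _<?_ to _<ᶠ?_)
import Data.Integer.Base as ℤ
import Data.Integer.Properties as ℤ
open import Data.List.Base using (List; []; _∷_; _++_; length; lookup)
import Data.List.Membership.DecPropositional as DecMembership
open import Data.List.Membership.Propositional using (_∈_; _∉_)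
open import Data.List.Membership.Propositional.Properties using (∈-lookup; ∈-++⁻)
open import Data.List.Relation.Binary.Subset.Propositional using (_⊆_)
open import Data.List.Relation.Unary.Any using (here; there)
open import Data.Nat.Base using (ℕ; zero; suc; _≤_; z≤n; s≤s; _%_) renaming (_+_ to _+ℕ_)
import Data.Nat.Properties as ℕ
open import Data.Product.Base using (_×_; _,_; proj₁; proj₂; ∃-syntax; Σ-syntax)
open import Data.Rational.Base
  using (ℚ; 0ℚ; 1ℚ; ½; _+_; _*_; _-_; -_; 1/_; ≢-nonZero; toℚᵘ)
import Data.Rational.Properties as ℚ
open import Data.Rational.Solver using (module +-*-Solver)
import Data.Rational.Unnormalised.Base as ℚᵘ
import Data.Rational.Unnormalised.Properties as ℚᵘ
import Data.Sum.Base as ⊎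
open import Data.Sum.Base using (_⊎_; inj₁; inj₂)
open import Data.Sum.Properties using (inj₁-injective; inj₂-injective)
import Data.Vec.Functional as Vector
open import Function.Base using (_∘_; id)
open import Function.Bundles using (_⇔_; mk⇔; module Inverse; module Equivalence)
open import Function.Properties.Inverse using (↔-sym; ↔-trans)
open import Relation.Binary.Construct.Closure.ReflexiveTransitive using (Star; ε; _◅_; gmap)
open import Relation.Binary.Definitions using (tri<; tri≈; tri>)
open import Relation.Binary.PropositionalEquality hiding (setoid; [_])
import Relation.Binary.Reasoning.Setoid as SetoidReasoning
open import Relation.Nullary.Decidable using (Dec; yes; no; does; dec-true; dec-false)
open import Relation.Nullary.Negation using (¬_; contradiction)
import Relation.Unary as U

open import Algebra.Properties.Group ℚ.+-0-group
  using (∙-cancelʳ; ⁻¹-involutive; x∙y⁻¹≈ε⇒x≈y)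
open import Algebra.Properties.Semiring.Sum (CommutativeRing.semiring ℚ.+-*-commutativeRing)
  using (*-distribʳ-sum)
open +-*-Solver using (solve; con; _:+_; _:*_; _:-_; :-_; _:=_)

private module ΣN = Sum ℕ.+-0-commutativeMonoid
open ΣN using () renaming (sum to sumℕ)
open Sum ℚ.+-0-commutativeMonoid
  using (sum-cong-≗; ∑-distrib-+; sum-permute; sum-replicate-zero) renaming (sum to sumℚ)

-- Conditionals, finite sums and counting.

if-yes : ∀ {A P : Set} (P? : Dec P) {x y : A} → P → (if does P? then x else y) ≡ x
if-yes P? p rewrite dec-true P? p = refl

if-no : ∀ {A P : Set} (P? : Dec P) {x y : A} → ¬ P → (if does P? then x else y) ≡ y
if-no P? ¬p rewrite dec-false P? ¬p = refl

module _ {a ℓ} (M : CommutativeMonoid a ℓ) where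
  open CommutativeMonoid M renaming (ε to 0#; _∙_ to _⊕_)
  private module Σ = Sum M

  -- Stated for any commutative monoid because it serves both rational sums of defects and the
  -- counting of fixed points in ℕ.
  sum-single : ∀ {n} (f : Fin n → Carrier) p → (∀ i → i ≢ p → f i ≈ 0#) → Σ.sum f ≈ f p
  sum-single {suc n} f zero z = begin
    f zero ⊕ Σ.sum (f ∘ suc)                    ≈⟨ ∙-congˡ (Σ.sum-cong-≋ (λ i → z (suc i) λ ())) ⟩
    f zero ⊕ Σ.sum {n} (Vector.replicate n 0#)  ≈⟨ ∙-congˡ (Σ.sum-replicate-zero n) ⟩
    f zero ⊕ 0#                                 ≈⟨ identityʳ (f zero) ⟩
    f zero                                      ∎
    where open SetoidReasoning setoid
  sum-single f (suc p) z = begin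
    f zero ⊕ Σ.sum (f ∘ suc)  ≈⟨ ∙-cong (z zero λ ()) (sum-single (f ∘ suc) p
                                   (λ i i≢p → z (suc i) (i≢p ∘ suc-injective))) ⟩
    0# ⊕ f (suc p)            ≈⟨ identityˡ (f (suc p)) ⟩
    f (suc p)                 ∎
    where open SetoidReasoning setoid

sum-pair : ∀ {n} (f : Fin n → ℚ) p q → p ≢ q →
           (∀ i → i ≢ p → i ≢ q → f i ≡ 0ℚ) → sumℚ f ≡ f p + f q
sum-pair f p q p≢q z = begin
  sumℚ f                    ≡⟨ sum-cong-≗ split ⟩
  sumℚ (λ i → g i + h i)    ≡⟨ ∑-distrib-+ g h ⟩
  sumℚ g + sumℚ h           ≡⟨ cong₂ _+_ (sum-single ℚ.+-0-commutativeMonoid g p g-zero) (sum-single ℚ.+-0-commutativeMonoid h q h-zero) ⟩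
  g p + h q                 ≡⟨ cong₂ _+_ g-p h-q ⟩
  f p + f q                 ∎
  where
  open ≡-Reasoning
  g h : _ → ℚ
  g i = if does (i ≟ᶠ p) then f i else 0ℚ
  h i = if does (i ≟ᶠ p) then 0ℚ else f i

  split : ∀ i → f i ≡ g i + h i
  split i with i ≟ᶠ p
  ... | yes _ = sym (ℚ.+-identityʳ (f i))
  ... | no _  = sym (ℚ.+-identityˡ (f i))

  g-zero : ∀ i → i ≢ p → g i ≡ 0ℚ
  g-zero i i≢p with i ≟ᶠ p
  ... | yes i≡p = contradiction i≡p i≢p
  ... | no _    = refl

  h-zero : ∀ i → i ≢ q → h i ≡ 0ℚ
  h-zero i i≢q with i ≟ᶠ p
  ... | yes _  = refl
  ... | no i≢p = z i i≢p i≢q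

  g-p : g p ≡ f p
  g-p with p ≟ᶠ p
  ... | yes _  = refl
  ... | no p≢p = contradiction refl p≢p

  h-q : h q ≡ f q
  h-q with q ≟ᶠ p
  ... | yes q≡p = contradiction (sym q≡p) p≢q
  ... | no _    = refl

-- Addition on ℚ normalises the fraction and is stuck on a variable `n`, so the equation is checked
-- on unnormalised fractions.
fromℕ-suc : ∀ n → fromℕ (suc n) ≡ 1ℚ + fromℕ n
fromℕ-suc n = ℚ.toℚᵘ-injective (ℚᵘ.≃-trans unnormalised
                (ℚᵘ.≃-sym (ℚ.toℚᵘ-homo-+ 1ℚ (fromℕ n))))
  where
  unnormalised : toℚᵘ (fromℕ (suc n)) ℚᵘ.≃ (toℚᵘ 1ℚ ℚᵘ.+ toℚᵘ (fromℕ n))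
  unnormalised = ℚᵘ.*≡* (cong (λ k → k ℤ.* ℤ.+ 1)
                   (sym (cong (λ k → ℤ.+ 1 ℤ.+ k) (ℤ.*-identityʳ (ℤ.+ n)))))

-- This turns the degree of a vertex into a row sum of the adjacency matrix.
fromℕ-count : ∀ {n} {P : Fin n → Set} (P? : U.Decidable P) →
              fromℕ (count P?) ≡ sumℚ (λ i → if does (P? i) then 1ℚ else 0ℚ)
fromℕ-count {zero}  P? = refl
fromℕ-count {suc n} P? with does (P? zero)
... | true  = trans (fromℕ-suc (count (P? ∘ suc))) (cong (1ℚ +_) (fromℕ-count (P? ∘ suc)))
... | false = trans (fromℕ-count (P? ∘ suc)) (sym (ℚ.+-identityˡ _))

-- Rational arithmetic and signs.

p≡-p⇒p≡0 : ∀ {p} → p ≡ - p → p ≡ 0ℚ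
p≡-p⇒p≡0 {p} p≡-p = begin
  p                ≡⟨ ℚ.*-identityˡ p ⟨
  (½ + ½) * p      ≡⟨ ℚ.*-distribʳ-+ p ½ ½ ⟩
  ½ * p + ½ * p    ≡⟨ ℚ.*-distribˡ-+ ½ p p ⟨
  ½ * (p + p)      ≡⟨ cong (λ q → ½ * (p + q)) p≡-p ⟩
  ½ * (p - p)      ≡⟨ cong (½ *_) (ℚ.+-inverseʳ p) ⟩
  ½ * 0ℚ           ≡⟨ ℚ.*-zeroʳ ½ ⟩
  0ℚ               ∎
  where open ≡-Reasoning

p*q≢0 : ∀ {p q} → p ≢ 0ℚ → q ≢ 0ℚ → p * q ≢ 0ℚ
p*q≢0 {p} {q} p≢0 q≢0 pq≡0 = q≢0 (begin
  q                  ≡⟨ ℚ.*-identityˡ q ⟨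
  1ℚ * q             ≡⟨ cong (_* q) (ℚ.*-inverseˡ p) ⟨
  (1/ p) * p * q     ≡⟨ ℚ.*-assoc (1/ p) p q ⟩
  (1/ p) * (p * q)   ≡⟨ cong ((1/ p) *_) pq≡0 ⟩
  (1/ p) * 0ℚ        ≡⟨ ℚ.*-zeroʳ (1/ p) ⟩
  0ℚ                 ∎)
  where
  open ≡-Reasoning
  instance _ = ≢-nonZero p≢0

-- Multiplication by (-1)^n, with the exponent kept as a number so that exponents can be summed
-- around the cycle.
flip : ℕ → ℚ → ℚ
flip zero    q = q
flip (suc n) q = - flip n q

flip-neg : ∀ n q → flip n (- q) ≡ - flip n q
flip-neg zero    q = refl
flip-neg (suc n) q = cong -_ (flip-neg n q)

flip-+ : ∀ m n q → flip (m +ℕ n) q ≡ flip m (flip n q)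
flip-+ zero    n q = refl
flip-+ (suc m) n q = cong -_ (flip-+ m n q)

flip-involutive : ∀ n q → flip n (flip n q) ≡ q
flip-involutive zero    q = refl
flip-involutive (suc n) q = begin
  - flip n (- flip n q)      ≡⟨ cong -_ (flip-neg n (flip n q)) ⟩
  - (- flip n (flip n q))    ≡⟨ ⁻¹-involutive (flip n (flip n q)) ⟩
  flip n (flip n q)          ≡⟨ flip-involutive n q ⟩
  q                          ∎
  where open ≡-Reasoning

flip-0 : ∀ n → flip n 0ℚ ≡ 0ℚ
flip-0 zero    = refl
flip-0 (suc n) = cong -_ (flip-0 n)

flip-homo : ∀ n p q → flip n (p + q) ≡ flip n p + flip n q
flip-homo zero    p q = refl
flip-homo (suc n) p q = trans (cong -_ (flip-homo n p q)) (ℚ.neg-distrib-+ (flip n p) (flip n q))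

flip-* : ∀ n p q → flip n (p * q) ≡ p * flip n q
flip-* zero    p q = refl
flip-* (suc n) p q = trans (cong -_ (flip-* n p q)) (ℚ.neg-distribʳ-* p (flip n q))

-- Matchings, the sign rule and the Laplacian.

module Index (G : Graph) where
  open Graph G using (enum; vertex)

  index : V G → Fin (order G)
  index = Inverse.from enum

  vertex-index : ∀ v → vertex (index v) ≡ v
  vertex-index = Inverse.strictlyInverseˡ enum

  index-vertex : ∀ i → index (vertex i) ≡ i
  index-vertex = Inverse.strictlyInverseʳ enum

-- A perfect matching as an involution that sends each vertex to a neighbour; since `Adj` is
-- irreflexive, it has no fixed points.
record Matching (G : Graph) : Set where
  open Graph G using (Adj)
  field
    mate            : V G → V G
    mate-adj        : ∀ u → Adj u (mate u)
    mate-involutive : ∀ u → mate (mate u) ≡ u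

matching : ∀ {G} → HasPerfectMatching G → Matching G
matching (M , M⊆Adj , M-sym , M-total) = record
  { mate            = λ u → proj₁ (M-total u)
  ; mate-adj        = λ u → M⊆Adj (proj₁ (proj₂ (M-total u)))
  ; mate-involutive = λ u → proj₂ (proj₂ (M-total (proj₁ (M-total u))))
                                  (M-sym (proj₁ (proj₂ (M-total u))))
  }

module Switching (G : Graph) (M : Matching G) where
  open Graph G hiding (V; order)
  open Index G
  open Matching M

  -- The exponent of the sign carried by an edge: matching edges carry -1, all others +1.
  weight : V G → V G → ℕ
  weight u v = if does (mate u ≟ⱽ v) then 1 else 0

  weight-mate : ∀ {u v} → mate u ≡ v → weight u v ≡ 1
  weight-mate e = if-yes (_ ≟ⱽ _) e

  weight-¬mate : ∀ {u v} → mate u ≢ v → weight u v ≡ 0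
  weight-¬mate e = if-no (_ ≟ⱽ _) e

  mate-sym : ∀ {u v} → mate u ≡ v → mate v ≡ u
  mate-sym {u} e = trans (cong mate (sym e)) (mate-involutive u)

  weight-sym : ∀ u v → weight u v ≡ weight v u
  weight-sym u v with mate u ≟ⱽ v
  ... | yes e = trans (weight-mate e) (sym (weight-mate (mate-sym e)))
  ... | no ¬e = trans (weight-¬mate ¬e) (sym (weight-¬mate (¬e ∘ mate-sym)))

  Good : (V G → ℚ) → V G → V G → Set
  Good x u v = x v ≡ flip (weight u v) (x u)

  Switched : (V G → ℚ) → Set
  Switched x = ∀ {u v} → Adj u v → Good x u v

  -- The amount by which the sign rule fails on an edge, directed from u to v. It is 0 on non-edges,
  -- so that it can be summed over all vertices.
  defect : (V G → ℚ) → V G → V G → ℚ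
  defect x u v = if does (Adj? u v) then flip (weight u v) (x u) - x v else 0ℚ

  Balanced : (V G → ℚ) → V G → Set
  Balanced x u = sumℚ (λ j → defect x u (vertex j)) ≡ 0ℚ

  Good-sym : ∀ {x} u v → Good x u v → Good x v u
  Good-sym {x} u v e = begin
    x u                                              ≡⟨ flip-involutive (weight u v) (x u) ⟨
    flip (weight u v) (flip (weight u v) (x u))      ≡⟨ cong₂ flip (weight-sym u v) (sym e) ⟩
    flip (weight v u) (x v)                          ∎
    where open ≡-Reasoning

  defect-edge : ∀ x {u v} → Adj u v → defect x u v ≡ flip (weight u v) (x u) - x v
  defect-edge x {u} {v} e =
    if-yes (Adj? u v) e

  Good⇒defect≡0 : ∀ x {u v} → (Adj u v → Good x u v) → defect x u v ≡ 0ℚ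
  Good⇒defect≡0 x {u} {v} good with Adj? u v
  ... | yes e = trans (cong (_-_ (flip (weight u v) (x u))) (good e))
                      (ℚ.+-inverseʳ (flip (weight u v) (x u)))
  ... | no _  = refl

  defect≡0⇒Good : ∀ x {u v} → Adj u v → defect x u v ≡ 0ℚ → Good x u v
  defect≡0⇒Good x {u} {v} e z = sym (x∙y⁻¹≈ε⇒x≈y _ _ (trans (sym (defect-edge x e)) z))

  -- The flip along an edge is additive and its own inverse, so reading the edge backwards flips the
  -- defect and negates it.
  defect-antisym : ∀ x {u v} → Adj u v → defect x v u ≡ - flip (weight u v) (defect x u v)
  defect-antisym x {u} {v} e = begin
    defect x v u                                     ≡⟨ defect-edge x (Adj-sym e) ⟩
    flip (weight v u) (x v) - x u                    ≡⟨ cong₂ (λ k p → flip k (x v) - p) (weight-sym v u)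
                                                          (sym (flip-involutive k₀ (x u))) ⟩
    flip k₀ (x v) - flip k₀ (flip k₀ (x u))          ≡⟨ ℚ.+-comm (flip k₀ (x v)) _ ⟩
    - flip k₀ (flip k₀ (x u)) + flip k₀ (x v)        ≡⟨ cong (- flip k₀ (flip k₀ (x u)) +_)
                                                          (⁻¹-involutive (flip k₀ (x v))) ⟨
    - flip k₀ (flip k₀ (x u)) - (- flip k₀ (x v))    ≡⟨ ℚ.neg-distrib-+ (flip k₀ (flip k₀ (x u))) _ ⟨
    - (flip k₀ (flip k₀ (x u)) - flip k₀ (x v))      ≡⟨ cong (λ q → - (flip k₀ (flip k₀ (x u)) + q)) (flip-neg k₀ (x v)) ⟨
    - (flip k₀ (flip k₀ (x u)) + flip k₀ (- x v))    ≡⟨ cong -_ (flip-homo k₀ (flip k₀ (x u)) (- x v)) ⟨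
    - flip k₀ (flip k₀ (x u) - x v)                  ≡⟨ cong (λ q → - flip k₀ q) (defect-edge x e) ⟨
    - flip k₀ (defect x u v)                         ∎
    where
    open ≡-Reasoning
    k₀ = weight u v

  -- The sign rule preserves absolute values along a walk. On a connected graph a switched vector
  -- therefore vanishes everywhere or nowhere.
  Switched-zero : ∀ x → Switched x → ∀ {u v} → Star Adj u v → x u ≡ 0ℚ → x v ≡ 0ℚ
  Switched-zero x s ε z = z
  Switched-zero x s {u} (_◅_ {j = w} e es) z = Switched-zero x s es
    (trans (s e) (trans (cong (flip (weight u w)) z) (flip-0 (weight u w))))

  Balanced-single : ∀ x u p → Balanced x u → (∀ w → w ≢ p → defect x u w ≡ 0ℚ) → defect x u p ≡ 0ℚ
  Balanced-single x u p b z = begin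
    defect x u p                                ≡⟨ cong (defect x u) (vertex-index p) ⟨
    defect x u (vertex (index p))               ≡⟨ sum-single ℚ.+-0-commutativeMonoid (defect x u ∘ vertex) (index p) others ⟨
    sumℚ (defect x u ∘ vertex)                  ≡⟨ b ⟩
    0ℚ                                          ∎
    where
    open ≡-Reasoning
    others : ∀ i → i ≢ index p → defect x u (vertex i) ≡ 0ℚ
    others i i≢p = z (vertex i) λ e → i≢p (trans (sym (index-vertex i)) (cong index e))

  Balanced-pair : ∀ x u p q → p ≢ q → Balanced x u →
                  (∀ w → w ≢ p → w ≢ q → defect x u w ≡ 0ℚ) → defect x u p + defect x u q ≡ 0ℚ
  Balanced-pair x u p q p≢q b z = begin
    defect x u p + defect x u q
      ≡⟨ cong₂ (λ p q → defect x u p + defect x u q) (vertex-index p) (vertex-index q) ⟨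
    defect x u (vertex (index p)) + defect x u (vertex (index q))
      ≡⟨ sum-pair (defect x u ∘ vertex) (index p) (index q) (p≢q ∘ index-injective) others ⟨
    sumℚ (defect x u ∘ vertex)
      ≡⟨ b ⟩
    0ℚ ∎
    where
    open ≡-Reasoning
    index-injective : ∀ {u v} → index u ≡ index v → u ≡ v
    index-injective {u} {v} e =
      trans (sym (vertex-index u)) (trans (cong vertex e) (vertex-index v))
    others : ∀ i → i ≢ index p → i ≢ index q → defect x u (vertex i) ≡ 0ℚ
    others i i≢p i≢q = z (vertex i)
      (λ e → i≢p (trans (sym (index-vertex i)) (cong index e)))
      (λ e → i≢q (trans (sym (index-vertex i)) (cong index e)))

  -- Exactly one edge at u is a matching edge, so the flipped terms at u add up to (deg u - 2) x(u).
  -- The defects at u thus sum to the entry of (L - 2I)x at u.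
  laplacian-defect : ∀ x i → (laplacian G · (x ∘ vertex)) i ≡
    sumℚ (λ j → defect x (vertex i) (vertex j)) + fromℕ 2 * x (vertex i)
  -- With deg(u) x(u) added on both sides, written as the sum of `A` on the left and of `d` on the
  -- right, the claim can be checked term by term.
  laplacian-defect x i = ∙-cancelʳ (fromℕ (degree u) * x u) _ _ (begin
    sumℚ L + fromℕ (degree u) * x u
      ≡⟨ cong (λ d → sumℚ L + d * x u) (fromℕ-count (λ j → Adj? u (vertex j))) ⟩
    sumℚ L + sumℚ (adjacencyMatrix G i) * x u
      ≡⟨ cong (sumℚ L +_) (*-distribʳ-sum (x u) (adjacencyMatrix G i)) ⟩
    sumℚ L + sumℚ A
      ≡⟨ ∑-distrib-+ L A ⟨
    sumℚ (λ j → L j + A j)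
      ≡⟨ sum-cong-≗ pointwise ⟩
    sumℚ (λ j → δ j + m j + d j)
      ≡⟨ trans (∑-distrib-+ (λ j → δ j + m j) d) (cong (_+ sumℚ d) (∑-distrib-+ δ m)) ⟩
    sumℚ δ + sumℚ m + sumℚ d
      ≡⟨ cong₂ (λ p q → sumℚ δ + p + q)
           (trans (sum-single ℚ.+-0-commutativeMonoid m (index (mate u)) m-zero) m-mate)
           (trans (sum-single ℚ.+-0-commutativeMonoid d i d-zero) d-diagonal) ⟩
    sumℚ δ + fromℕ 2 * x u + fromℕ (degree u) * x u
      ∎)
    where
    open ≡-Reasoning
    u = vertex i
    L A δ m d : Fin (order G) → ℚ
    L j = laplacian G i j * x (vertex j)
    A j = adjacencyMatrix G i j * x u
    δ j = defect x u (vertex j)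
    m j = if does (mate u ≟ⱽ vertex j) then fromℕ 2 * x u else 0ℚ
    d j = if does (i ≟ᶠ j) then fromℕ (degree u) * x u else 0ℚ

    m-zero : ∀ j → j ≢ index (mate u) → m j ≡ 0ℚ
    m-zero j j≢ = if-no (mate u ≟ⱽ vertex j)
      λ e → j≢ (trans (sym (index-vertex j)) (cong index (sym e)))

    m-mate : m (index (mate u)) ≡ fromℕ 2 * x u
    m-mate = if-yes (mate u ≟ⱽ vertex (index (mate u))) (sym (vertex-index (mate u)))

    d-zero : ∀ j → j ≢ i → d j ≡ 0ℚ
    d-zero j j≢i = if-no (i ≟ᶠ j) (j≢i ∘ sym)

    d-diagonal : d i ≡ fromℕ (degree u) * x u
    d-diagonal = if-yes (i ≟ᶠ i) refl

    a≡1 : ∀ {j} → Adj u (vertex j) → adjacencyMatrix G i j ≡ 1ℚ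
    a≡1 e = if-yes (Adj? _ _) e

    diagonal : ∀ j → degreeMatrix G i j * x (vertex j) ≡ d j
    diagonal j with i ≟ᶠ j
    ... | yes refl = refl
    ... | no _     = ℚ.*-zeroˡ (x (vertex j))

    -- On the matching edge the defect is -x(u) - y, where the Laplacian has x(u) - y; the
    -- correction 2x(u) in `m` makes up the difference. Elsewhere the two agree.
    off-diagonal : ∀ j → A j - adjacencyMatrix G i j * x (vertex j) ≡ δ j + m j
    off-diagonal j with mate u ≟ⱽ vertex j
    ... | yes e = begin
      A j - adjacencyMatrix G i j * y   ≡⟨ cong (λ a → a * x u - a * y) (a≡1 adj) ⟩
      1ℚ * x u - 1ℚ * y                 ≡⟨ solve 2 (λ p q → con 1ℚ :* p :- con 1ℚ :* q := (:- p :- q) :+ con (fromℕ 2) :* p) refl (x u) y ⟩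
      - x u - y + fromℕ 2 * x u         ≡⟨ cong₂ _+_ (trans (defect-edge x adj) (cong (λ k → flip k (x u) - y) (weight-mate e)))
                                             (if-yes (mate u ≟ⱽ vertex j) e) ⟨
      δ j + m j                         ∎
      where
      y = x (vertex j)
      adj = subst (Adj u) e (mate-adj u)
    ... | no ¬e = trans difference (trans (sym (ℚ.+-identityʳ (δ j)))
        (cong (δ j +_) (sym (if-no (mate u ≟ⱽ vertex j) ¬e))))
      where
      y = x (vertex j)
      difference : A j - adjacencyMatrix G i j * y ≡ δ j
      difference with Adj? u (vertex j)
      ... | yes _ = trans (cong₂ _-_ (ℚ.*-identityˡ (x u)) (ℚ.*-identityˡ y))
                          (cong (λ k → flip k (x u) - y) (sym (weight-¬mate ¬e)))
      ... | no _  = cong₂ _-_ (ℚ.*-zeroˡ (x u)) (ℚ.*-zeroˡ y)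

    pointwise : ∀ j → L j + A j ≡ δ j + m j + d j
    pointwise j = begin
      (D - a) * y + a * x u    ≡⟨ solve 4 (λ D a y z → (D :- a) :* y :+ a :* z := (a :* z :- a :* y) :+ D :* y)
                                    refl D a y (x u) ⟩
      (a * x u - a * y) + D * y  ≡⟨ cong₂ _+_ (off-diagonal j) (diagonal j) ⟩
      δ j + m j + d j          ∎
      where
      D = degreeMatrix G i j
      a = adjacencyMatrix G i j
      y = x (vertex j)

  -- By `laplacian-defect`, balance at every vertex is the eigenvalue equation. Vectors indexed by
  -- `Fin` become functions on vertices here, and all later arguments use the latter.
  HasEigenvalue⇔Balanced : HasEigenvalue (laplacian G) (fromℕ 2) ⇔
    (∃[ x ] ¬ (∀ v → x v ≡ 0ℚ) × (∀ u → Balanced x u))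
  HasEigenvalue⇔Balanced = mk⇔
    (λ (y , y≢0 , eigen) → y ∘ index ,
      (λ z → y≢0 λ i → trans (cong y (sym (index-vertex i))) (z (vertex i))) ,
      λ u → subst (Balanced (y ∘ index)) (vertex-index u) (balanced y eigen (index u)))
    (λ (x , x≢0 , balanced) → x ∘ vertex ,
      (λ z → x≢0 λ v → trans (cong x (sym (vertex-index v))) (z (index v))) ,
      λ i → trans (laplacian-defect x i)
        (trans (cong (_+ fromℕ 2 * x (vertex i)) (balanced (vertex i)))
               (ℚ.+-identityˡ (fromℕ 2 * x (vertex i)))))
    where
    balanced : ∀ y → (∀ i → (laplacian G · y) i ≡ fromℕ 2 * y i) →
               ∀ i → Balanced (y ∘ index) (vertex i)
    balanced y eigen i = ∙-cancelʳ (fromℕ 2 * y (index (vertex i))) _ _ (begin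
      sumℚ (λ j → defect (y ∘ index) (vertex i) (vertex j)) + fromℕ 2 * y (index (vertex i))
        ≡⟨ laplacian-defect (y ∘ index) i ⟨
      (laplacian G · (y ∘ index ∘ vertex)) i
        ≡⟨ sum-cong-≗ (λ j → cong (λ k → laplacian G i j * y k) (index-vertex j)) ⟩
      (laplacian G · y) i
        ≡⟨ eigen i ⟩
      fromℕ 2 * y i
        ≡⟨ cong (λ k → fromℕ 2 * y k) (index-vertex i) ⟨
      fromℕ 2 * y (index (vertex i))
        ≡⟨ ℚ.+-identityˡ _ ⟨
      0ℚ + fromℕ 2 * y (index (vertex i))
        ∎)
      where open ≡-Reasoning

  Switched⇒Balanced : ∀ x → Switched x → ∀ u → Balanced x u
  Switched⇒Balanced x s u =
    trans (sum-cong-≗ (λ j → Good⇒defect≡0 x {u} {vertex j} s)) (sum-replicate-zero (order G))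

-- Parity

%2-cases : ∀ n → n % 2 ≡ 0 ⊎ n % 2 ≡ 1
%2-cases zero          = inj₁ refl
%2-cases (suc zero)    = inj₂ refl
%2-cases (suc (suc n)) = %2-cases n

double-%2 : ∀ n k → (n +ℕ n +ℕ k) % 2 ≡ k % 2
double-%2 zero    k = refl
double-%2 (suc n) k = trans (cong (λ m → (suc m +ℕ k) % 2) (ℕ.+-suc n n)) (double-%2 n k)

double-suc-suc : ∀ n → suc (suc n) +ℕ suc (suc n) ≡ 4 +ℕ (n +ℕ n)
double-suc-suc n = cong (2 +ℕ_) (trans (ℕ.+-suc n (suc n)) (cong suc (ℕ.+-suc n n)))

even-double-%4 : ∀ n → n % 2 ≡ 0 → (n +ℕ n) % 4 ≡ 0
even-double-%4 zero          e = refl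
even-double-%4 (suc (suc n)) e = trans (cong (_% 4) (double-suc-suc n)) (even-double-%4 n e)

odd-double-%4 : ∀ n → n % 2 ≡ 1 → (n +ℕ n) % 4 ≡ 2
odd-double-%4 (suc zero)    e = refl
odd-double-%4 (suc (suc n)) e = trans (cong (_% 4) (double-suc-suc n)) (odd-double-%4 n e)

flip-even : ∀ n q → n % 2 ≡ 0 → flip n q ≡ q
flip-even zero          q e = refl
flip-even (suc (suc n)) q e = trans (⁻¹-involutive (flip n q)) (flip-even n q e)

flip-odd : ∀ n q → n % 2 ≡ 1 → flip n q ≡ - q
flip-odd (suc zero)    q e = refl
flip-odd (suc (suc n)) q e = trans (⁻¹-involutive (flip n q)) (flip-odd n q e)

-- An involution pairs off the points it moves.
module _ {n} (τ : Fin n → Fin n) (τ-involutive : ∀ i → τ (τ i) ≡ i) where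
  private
    ascent descent fixed : Fin n → ℕ
    ascent i  = if does (i <ᶠ? τ i) then 1 else 0
    descent i = if does (τ i <ᶠ? i) then 1 else 0
    fixed i   = if does (τ i ≟ᶠ i) then 1 else 0

    trichotomy : ∀ i → 1 ≡ ascent i +ℕ descent i +ℕ fixed i
    trichotomy i with <-cmp i (τ i)
    ... | tri< i<τi i≢τi i≯τi = sym (cong₂ _+ℕ_ (cong₂ _+ℕ_ (if-yes (i <ᶠ? τ i) i<τi)
            (if-no (τ i <ᶠ? i) i≯τi)) (if-no (τ i ≟ᶠ i) (i≢τi ∘ sym)))
    ... | tri≈ i≮τi i≡τi i≯τi = sym (cong₂ _+ℕ_ (cong₂ _+ℕ_ (if-no (i <ᶠ? τ i) i≮τi)
            (if-no (τ i <ᶠ? i) i≯τi)) (if-yes (τ i ≟ᶠ i) (sym i≡τi)))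
    ... | tri> i≮τi i≢τi i>τi = sym (cong₂ _+ℕ_ (cong₂ _+ℕ_ (if-no (i <ᶠ? τ i) i≮τi)
            (if-yes (τ i <ᶠ? i) i>τi)) (if-no (τ i ≟ᶠ i) (i≢τi ∘ sym)))

    -- Replacing i by `τ i` exchanges the conditions i < `τ i` and `τ i` < i.
    ascents≡descents : sumℕ ascent ≡ sumℕ descent
    ascents≡descents = trans
      (ΣN.sum-permute ascent (permutation τ τ τ-involutive τ-involutive))
      (ΣN.sum-cong-≗ λ i → cong (λ j → if does (τ i <ᶠ? j) then 1 else 0) (τ-involutive i))

    sum-ones : ∀ m → m ≡ sumℕ {m} (λ _ → 1)
    sum-ones zero    = refl
    sum-ones (suc m) = cong suc (sum-ones m)

  involution-parity : n % 2 ≡ count (λ i → τ i ≟ᶠ i) % 2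
  involution-parity = trans (cong (_% 2) (begin
    n                                                    ≡⟨ sum-ones n ⟩
    sumℕ {n} (λ _ → 1)                                   ≡⟨ ΣN.sum-cong-≗ trichotomy ⟩
    sumℕ (λ i → ascent i +ℕ descent i +ℕ fixed i)        ≡⟨ ΣN.∑-distrib-+ (λ i → ascent i +ℕ descent i) fixed ⟩
    sumℕ (λ i → ascent i +ℕ descent i) +ℕ sumℕ fixed     ≡⟨ cong (_+ℕ sumℕ fixed) (ΣN.∑-distrib-+ ascent descent) ⟩
    sumℕ ascent +ℕ sumℕ descent +ℕ sumℕ fixed            ≡⟨ cong (λ d → sumℕ ascent +ℕ d +ℕ sumℕ fixed) ascents≡descents ⟨
    sumℕ ascent +ℕ sumℕ ascent +ℕ sumℕ fixed             ∎))
    (double-%2 (sumℕ ascent) (sumℕ fixed))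
    where open ≡-Reasoning

module _ (G : Graph) (τ : V G → V G) (τ-involutive : ∀ v → τ (τ v) ≡ v) where
  open Graph G using (vertex)
  open Index G
  private
    τᶠ : Fin (order G) → Fin (order G)
    τᶠ = index ∘ τ ∘ vertex

    τᶠ-involutive : ∀ i → τᶠ (τᶠ i) ≡ i
    τᶠ-involutive i = trans (cong (index ∘ τ) (vertex-index (τ (vertex i))))
      (trans (cong index (τ-involutive (vertex i))) (index-vertex i))

    τᶠ-fixed : ∀ {i} → τᶠ i ≡ i → τ (vertex i) ≡ vertex i
    τᶠ-fixed e = trans (sym (vertex-index _)) (cong vertex e)

  fixed-point-free⇒even : (∀ v → τ v ≢ v) → order G % 2 ≡ 0
  fixed-point-free⇒even moved = trans (involution-parity τᶠ τᶠ-involutive) (cong (_% 2)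
    (trans (ΣN.sum-cong-≗ λ i → if-no (τᶠ i ≟ᶠ i) (moved (vertex i) ∘ τᶠ-fixed))
           (ΣN.sum-replicate-zero (order G))))

  one-fixed-point⇒odd : ∀ r → τ r ≡ r → (∀ v → τ v ≡ v → v ≡ r) → order G % 2 ≡ 1
  one-fixed-point⇒odd r fixed unique = trans (involution-parity τᶠ τᶠ-involutive) (cong (_% 2)
    (trans (sum-single ℕ.+-0-commutativeMonoid _ (index r) λ i i≢r → if-no (τᶠ i ≟ᶠ i)
              (λ e → i≢r (trans (sym (index-vertex i)) (cong index (unique (vertex i) (τᶠ-fixed e))))))
           (if-yes (τᶠ (index r) ≟ᶠ index r)
              (cong index (trans (cong τ (vertex-index r)) fixed)))))

-- Trees

module _ {G : Graph} where
  open Graph G using (Adj)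

  -- Simple paths, indexed by the list of their vertices so that a cycle can be read off with
  -- `lookup`.
  data Path : V G → V G → List (V G) → Set where
    [_]      : ∀ u → Path u u (u ∷ [])
    _∷⟨_,_⟩_ : ∀ {v w ws} u → Adj u w → u ∉ ws → Path w v ws → Path u v (u ∷ ws)

  path-snoc : ∀ {u v w ws} → Path u v ws → Adj v w → w ∉ ws → Path u w (ws ++ w ∷ [])
  path-snoc {w = w} [ u ] e w∉ = u ∷⟨ e , (λ { (here refl) → w∉ (here refl) }) ⟩ [ w ]
  path-snoc {w = w} (_∷⟨_,_⟩_ {ws = ws} u e u∉ p) e′ w∉ =
    u ∷⟨ e , u∉′ ⟩ path-snoc p e′ (w∉ ∘ there)
    where
    u∉′ : u ∉ ws ++ w ∷ []
    u∉′ u∈ with ∈-++⁻ ws u∈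
    ... | inj₁ u∈ws        = u∉ u∈ws
    ... | inj₂ (here refl) = w∉ (here refl)

  -- The index conditions here and in `path-last` and `path-step` are those in the two alternatives
  -- of `Next`, which is how `path-cycle` uses them.
  path-first : ∀ {u v ws} → Path u v ws → ∀ i → toℕ i ≡ 0 → lookup ws i ≡ u
  path-first [ u ]            zero e = refl
  path-first (u ∷⟨ _ , _ ⟩ _) zero e = refl

  path-last : ∀ {u v ws} → Path u v ws → ∀ i → suc (toℕ i) ≡ length ws → lookup ws i ≡ v
  path-last [ u ]            zero    e = refl
  path-last (u ∷⟨ _ , _ ⟩ p) (suc i) e = path-last p i (ℕ.suc-injective e)
  path-last (u ∷⟨ _ , _ ⟩ [ _ ]) zero ()
  path-last (u ∷⟨ _ , _ ⟩ (_ ∷⟨ _ , _ ⟩ _)) zero ()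

  path-step : ∀ {u v ws} → Path u v ws →
              ∀ i j → toℕ j ≡ suc (toℕ i) → Adj (lookup ws i) (lookup ws j)
  path-step [ u ] zero zero ()
  path-step (u ∷⟨ e , _ ⟩ p) zero    (suc j) eq =
    subst (Adj u) (sym (path-first p j (ℕ.suc-injective eq))) e
  path-step (u ∷⟨ _ , _ ⟩ p) (suc i) (suc j) eq = path-step p i j (ℕ.suc-injective eq)

  path-injective : ∀ {u v ws} → Path u v ws → ∀ i j → lookup ws i ≡ lookup ws j → i ≡ j
  path-injective [ u ] zero zero _ = refl
  path-injective (u ∷⟨ _ , _ ⟩ _) zero zero _ = refl
  path-injective (_∷⟨_,_⟩_ {ws = ws} u _ u∉ _) zero (suc j) eq =
    contradiction (subst (_∈ ws) (sym eq) (∈-lookup j)) u∉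
  path-injective (_∷⟨_,_⟩_ {ws = ws} u _ u∉ _) (suc i) zero eq =
    contradiction (subst (_∈ ws) eq (∈-lookup i)) u∉
  path-injective (u ∷⟨ _ , _ ⟩ p) (suc i) (suc j) eq = cong suc (path-injective p i j eq)

  path-cycle : ∀ {u v ws} → Path u v ws → Adj v u → 3 ≤ length ws → CycleIn G (length ws)
  path-cycle {ws = ws} p e 3≤ = record
    { 3≤k       = 3≤
    ; cyc       = lookup ws
    ; injective = path-injective p _ _
    ; adjacent  = λ
      { {i} {j} (inj₁ s)       → path-step p i j s
      ; {i} {j} (inj₂ (l , z)) → subst₂ Adj (sym (path-last p i l)) (sym (path-first p j z)) e
      }
    }

module Tree (G : Graph) (isTree : IsTree G) (r : V G) where
  open Graph G using (Adj; Adj-sym; Adj-irrefl; _≟ⱽ_; vertex)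
  open Index G
  open DecMembership _≟ⱽ_ using (_∈?_)

  -- Read from its head, the list strips leaves off the tree until only r is left.
  data Peeling : List (V G) → Set where
    root : Peeling (r ∷ [])
    leaf : ∀ {v vs} p → v ∉ vs → p ∈ vs → Adj v p → (∀ {w} → w ∈ vs → Adj v w → w ≡ p) →
           Peeling vs → Peeling (v ∷ vs)

  root∈ : ∀ {vs} → Peeling vs → r ∈ vs
  root∈ root                  = here refl
  root∈ (leaf _ _ _ _ _ peel) = there (root∈ peel)

  -- Paths run through the parents `p` of the leaves. Staying inside `vs` matters: a vertex outside
  -- `vs` can then be attached without repetition.
  peeling-path : ∀ {vs u v} → Peeling vs → u ∈ vs → v ∈ vs → ∃[ ws ] Path {G} u v ws × ws ⊆ vs
  peeling-path root (here refl) (here refl) = _ , [ r ] , id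
  peeling-path (leaf _ _ _ _ _ _) (here refl) (here refl) =
    _ , [ _ ] , λ { (here refl) → here refl }
  peeling-path (leaf p v∉ p∈ e _ peel) (here refl) (there v∈vs)
    with ws , path , ⊆vs ← peeling-path peel p∈ v∈vs =
    _ , _ ∷⟨ e , v∉ ∘ ⊆vs ⟩ path , λ { (here refl) → here refl ; (there w∈) → there (⊆vs w∈) }
  peeling-path {v ∷ vs} (leaf p v∉ p∈ e _ peel) (there u∈vs) (here refl)
    with ws , path , ⊆vs ← peeling-path peel u∈vs p∈ =
    _ , path-snoc path (Adj-sym e) (v∉ ∘ ⊆vs) , ⊆v∷vs
    where
    ⊆v∷vs : ws ++ v ∷ [] ⊆ v ∷ vs
    ⊆v∷vs w∈ with ∈-++⁻ ws w∈
    ... | inj₁ w∈ws        = there (⊆vs w∈ws)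
    ... | inj₂ (here refl) = here refl
  peeling-path (leaf _ _ _ _ _ peel) (there u∈vs) (there v∈vs)
    with ws , path , ⊆vs ← peeling-path peel u∈vs v∈vs = ws , path , there ∘ ⊆vs

  -- Two neighbours of v in the peeling would close a cycle through v.
  unique-neighbour : ∀ {vs v p w} → Peeling vs → v ∉ vs →
                     p ∈ vs → Adj v p → w ∈ vs → Adj v w → w ≡ p
  unique-neighbour {p = p} {w} peel v∉ p∈ v~p w∈ v~w with w ≟ⱽ p
  ... | yes w≡p = w≡p
  ... | no w≢p with ws , path , ⊆vs ← peeling-path peel p∈ w∈ =
    contradiction
      (path-cycle (_ ∷⟨ v~p , v∉ ∘ ⊆vs ⟩ path) (Adj-sym v~w) (s≤s (2≤length path)))
      (proj₂ isTree _)
    where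
    -- The path has distinct ends, hence two vertices at least; v is the third vertex of the cycle.
    2≤length : ∀ {ws} → Path p w ws → 2 ≤ length ws
    2≤length [ _ ]                           = contradiction refl w≢p
    2≤length (_ ∷⟨ _ , _ ⟩ [ _ ])            = s≤s (s≤s z≤n)
    2≤length (_ ∷⟨ _ , _ ⟩ (_ ∷⟨ _ , _ ⟩ _)) = s≤s (s≤s z≤n)

  -- Along the walk, each vertex not yet listed joins as a leaf whose parent is the vertex before
  -- it; `unique-neighbour` supplies the leaf condition.
  grow : ∀ {vs u v} → Peeling vs → u ∈ vs → Star Adj u v →
         ∃[ vs′ ] Peeling vs′ × vs ⊆ vs′ × v ∈ vs′
  grow peel u∈ ε = _ , peel , id , u∈
  grow {vs} peel u∈ (_◅_ {j = w} e es) with w ∈? vs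
  ... | yes w∈ = grow peel w∈ es
  ... | no w∉
    with vs′ , peel′ , ⊆vs′ , v∈ ← grow (leaf _ w∉ u∈ (Adj-sym e)
           (unique-neighbour peel w∉ u∈ (Adj-sym e)) peel) (here refl) es =
    vs′ , peel′ , ⊆vs′ ∘ there , v∈

  grow-all : ∀ {n vs} (f : Fin n → V G) → Peeling vs →
             ∃[ vs′ ] Peeling vs′ × vs ⊆ vs′ × (∀ i → f i ∈ vs′)
  grow-all {zero}  f peel = _ , peel , id , λ ()
  grow-all {suc n} f peel
    with vs₁ , peel₁ , ⊆₁ , ∈₁ ← grow peel (root∈ peel) (proj₂ (proj₁ isTree) r (f zero))
    with vs₂ , peel₂ , ⊆₂ , ∈₂ ← grow-all (f ∘ suc) peel₁ =
    vs₂ , peel₂ , ⊆₂ ∘ ⊆₁ , λ { zero → ⊆₂ ∈₁ ; (suc i) → ∈₂ i }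

  peeling : ∃[ vs ] Peeling vs × (∀ v → v ∈ vs)
  peeling with vs , peel , _ , ∈vs ← grow-all vertex root =
    vs , peel , λ v → subst (_∈ vs) (vertex-index v) (∈vs (index v))

  module _ (k : V G → V G → ℕ) (k-sym : ∀ u v → k u v ≡ k v u) (q : ℚ) where

    private
      -- Each new leaf has a single edge into `vs`, and that edge dictates its value, so no conflict
      -- can arise.
      extend : ∀ {vs} → Peeling vs →
        Σ[ x ∈ (V G → ℚ) ] x r ≡ q × (∀ {u v} → u ∈ vs → v ∈ vs → Adj u v → x v ≡ flip (k u v) (x u))
      extend root = (λ _ → q) , refl ,
        λ { (here refl) (here refl) e → contradiction e (Adj-irrefl refl) }
      extend {v ∷ vs} (leaf p v∉ p∈ v~p unique peel) with x , x-r , x-vs ← extend peel =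
        x′ , trans (x′-old (root∈ peel)) x-r , x′-vs
        where
        x′ : V G → ℚ
        x′ w = if does (w ≟ⱽ v) then flip (k p v) (x p) else x w

        x′-v : x′ v ≡ flip (k p v) (x p)
        x′-v = if-yes (v ≟ⱽ v) refl

        x′-old : ∀ {w} → w ∈ vs → x′ w ≡ x w
        x′-old {w} w∈ = if-no (w ≟ⱽ v) λ { refl → v∉ w∈ }

        x′-vs : ∀ {u w} → u ∈ v ∷ vs → w ∈ v ∷ vs → Adj u w → x′ w ≡ flip (k u w) (x′ u)
        x′-vs (here refl) (here refl) e = contradiction e (Adj-irrefl refl)
        x′-vs (here refl) (there w∈) e with refl ← unique w∈ e = begin
          x′ p                                 ≡⟨ x′-old p∈ ⟩
          x p                                  ≡⟨ flip-involutive (k p v) (x p) ⟨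
          flip (k p v) (flip (k p v) (x p))    ≡⟨ cong₂ flip (k-sym p v) (sym x′-v) ⟩
          flip (k v p) (x′ v)                  ∎
          where open ≡-Reasoning
        x′-vs (there u∈) (here refl) e with refl ← unique u∈ (Adj-sym e) =
          trans x′-v (cong (flip (k p v)) (sym (x′-old p∈)))
        x′-vs {u} {w} (there u∈) (there w∈) e =
          trans (x′-old w∈) (trans (x-vs u∈ w∈ e) (cong (flip (k u w)) (sym (x′-old u∈))))

    -- The weight `k` is any symmetric function: the signs on a tree will come from a matching of
    -- the whole unicyclic graph, which may match the root outside the tree.
    tree-switching : Σ[ x ∈ (V G → ℚ) ] x r ≡ q × (∀ {u v} → Adj u v → x v ≡ flip (k u v) (x u))
    tree-switching with _ , peel , ∈vs ← peeling with x , x-r , x-vs ← extend peel =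
      x , x-r , x-vs (∈vs _) (∈vs _)

  module _ (P : V G → V G → Set) (P-sym : ∀ {u v} → P u v → P v u)
           (step : ∀ {u} → u ≢ r → ∀ p → (∀ w → Adj u w → w ≢ p → P u w) → Adj u p → P u p) where

    private
      Done : V G → Set
      Done u = ∀ w → Adj u w → P u w

      -- When v is at the head, every neighbour of v other than p has already been stripped and is
      -- done. So only the edge to p is open, and `step` settles it.
      peel-done : ∀ {vs} → Peeling vs → (∀ u → u ∈ vs ⊎ Done u) → ∀ u → u ≢ r → Done u
      peel-done root done u u≢r with done u
      ... | inj₁ (here u≡r) = contradiction u≡r u≢r
      ... | inj₂ d          = d
      peel-done {v ∷ vs} (leaf p v∉ p∈ v~p unique peel) done = peel-done peel done′
        where
        others : ∀ w → Adj v w → w ≢ p → P v w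
        others w e w≢p with done w
        ... | inj₁ (here refl) = contradiction e (Adj-irrefl refl)
        ... | inj₁ (there w∈)  = contradiction (unique w∈ e) w≢p
        ... | inj₂ d           = P-sym (d v (Adj-sym e))

        v-done : Done v
        v-done w e with w ≟ⱽ p
        ... | no w≢p   = others w e w≢p
        ... | yes refl = step (λ { refl → v∉ (root∈ peel) }) p others e

        done′ : ∀ u → u ∈ vs ⊎ Done u
        done′ u with done u
        ... | inj₁ (here refl) = inj₂ v-done
        ... | inj₁ (there u∈)  = inj₁ u∈
        ... | inj₂ d           = inj₂ d

    -- Every vertex other than r is eventually stripped, and each edge has an end different from r.
    leaf-induction : ∀ {u v} → Adj u v → P u v
    leaf-induction {u} {v} e with _ , peel , ∈vs ← peeling with u ≟ⱽ r
    ... | no u≢r   = peel-done peel (inj₁ ∘ ∈vs) u u≢r v e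
    ... | yes refl =
      P-sym (peel-done peel (inj₁ ∘ ∈vs) v (λ { refl → Adj-irrefl refl e }) u (Adj-sym e))

-- The cycle

cyclic-pred : ∀ {m} → Fin (suc m) → Fin (suc m)
cyclic-pred zero    = top _
cyclic-pred (suc i) = inject₁ i

Next-pred : ∀ {m} (i : Fin (suc m)) → Next (cyclic-pred i) i
Next-pred {m} zero = inj₂ (cong suc (toℕ-fromℕ m) , refl)
Next-pred (suc i)  = inj₁ (cong suc (sym (toℕ-inject₁ i)))

Next-functional : ∀ {g} {i j k : Fin g} → Next i j → Next i k → j ≡ k
Next-functional (inj₁ p)       (inj₁ q)         = toℕ-injective (trans p (sym q))
Next-functional {j = j} (inj₁ p) (inj₂ (q , _)) = contradiction (trans p q) (ℕ.<⇒≢ (toℕ<n j))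
Next-functional {k = k} (inj₂ (q , _)) (inj₁ p) = contradiction (trans p q) (ℕ.<⇒≢ (toℕ<n k))
Next-functional (inj₂ (_ , p)) (inj₂ (_ , q))   = toℕ-injective (trans p (sym q))

Next-injective : ∀ {g} {i j k : Fin g} → Next i k → Next j k → i ≡ j
Next-injective (inj₁ p)       (inj₁ q)       = toℕ-injective (ℕ.suc-injective (trans (sym p) q))
Next-injective (inj₁ p)       (inj₂ (_ , q)) with () ← trans (sym p) q
Next-injective (inj₂ (_ , p)) (inj₁ q)       with () ← trans (sym q) p
Next-injective (inj₂ (p , _)) (inj₂ (q , _)) = toℕ-injective (ℕ.suc-injective (trans p (sym q)))

-- Two indices that succeed each other would form a cycle of length at most 2. This keeps the two
-- cycle neighbours of a root distinct.
Next-asym : ∀ {g} {i j : Fin g} → 3 ≤ g → Next i j → ¬ Next j i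
Next-asym {i = i} {j} _ (inj₁ p) (inj₁ q) =
  ℕ.m≢1+m+n (toℕ i) {1} (trans q (cong suc (trans p (ℕ.+-comm 1 (toℕ i)))))
Next-asym 3≤g (inj₁ p) (inj₂ (l , z)) =
  ℕ.<⇒≢ 3≤g (trans (cong (2 +ℕ_) (sym z)) (trans (cong suc (sym p)) l))
Next-asym 3≤g (inj₂ (l , z)) (inj₁ p) =
  ℕ.<⇒≢ 3≤g (trans (cong (2 +ℕ_) (sym z)) (trans (cong suc (sym p)) l))
Next-asym 3≤g (inj₂ (l , z)) (inj₂ (l′ , z′)) =
  ℕ.<⇒≢ (ℕ.≤-trans (s≤s (s≤s z≤n)) 3≤g) (trans (cong suc (sym z)) l′)

sum-cyclic-pred : ∀ {m} (f : Fin (suc m) → ℕ) → sumℕ (f ∘ cyclic-pred) ≡ sumℕ f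
sum-cyclic-pred {m} f = trans (ℕ.+-comm (f (top m)) _) (sym (ΣN.sum-init-last f))

flip-chain : ∀ {m} (a : Fin (suc m) → ℚ) (f : Fin m → ℕ) →
  (∀ i → a (suc i) ≡ flip (f i) (a (inject₁ i))) → a (top m) ≡ flip (sumℕ f) (a zero)
flip-chain {zero}  a f s = refl
flip-chain {suc m} a f s = begin
  a (suc (top m))                                ≡⟨ flip-chain (a ∘ suc) (f ∘ suc) (s ∘ suc) ⟩
  flip (sumℕ (f ∘ suc)) (a (suc zero))             ≡⟨ cong (flip (sumℕ (f ∘ suc))) (s zero) ⟩
  flip (sumℕ (f ∘ suc)) (flip (f zero) (a zero))   ≡⟨ flip-+ (sumℕ (f ∘ suc)) (f zero) (a zero) ⟨
  flip (sumℕ (f ∘ suc) +ℕ f zero) (a zero)         ≡⟨ cong (λ n → flip n (a zero)) (ℕ.+-comm _ (f zero)) ⟩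
  flip (sumℕ f) (a zero)                           ∎
  where open ≡-Reasoning

flip-chain-zero : ∀ {m} (a : Fin (suc m) → ℚ) (f : Fin m → ℕ) →
  (∀ i → a (suc i) ≡ flip (f i) (a (inject₁ i))) → a zero ≡ 0ℚ → ∀ i → a i ≡ 0ℚ
flip-chain-zero a f s z zero = z
flip-chain-zero {suc m} a f s z (suc i) = flip-chain-zero (a ∘ suc) (f ∘ suc) (s ∘ suc)
  (trans (s zero) (trans (cong (flip (f zero)) z) (flip-0 (f zero)))) i

-- Going once around multiplies `a zero` by (-1) to the sum of `f`, that is by -1, so `a zero` is
-- its own negative. The entry `f zero` belongs to the closing step from `top m` to `zero`.
odd-cycle-zero : ∀ {m} (a : Fin (suc m) → ℚ) (f : Fin (suc m) → ℕ) →
  (∀ i → a i ≡ flip (f i) (a (cyclic-pred i))) → sumℕ f % 2 ≡ 1 → ∀ i → a i ≡ 0ℚ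
odd-cycle-zero {m} a f s odd = flip-chain-zero a (f ∘ suc) (s ∘ suc) (p≡-p⇒p≡0 (begin
  a zero                                                 ≡⟨ s zero ⟩
  flip (f zero) (a (top m))                            ≡⟨ cong (flip (f zero)) (flip-chain a (f ∘ suc) (s ∘ suc)) ⟩
  flip (f zero) (flip (sumℕ (f ∘ suc)) (a zero))         ≡⟨ flip-+ (f zero) (sumℕ (f ∘ suc)) (a zero) ⟨
  flip (sumℕ f) (a zero)                                 ≡⟨ flip-odd (sumℕ f) (a zero) odd ⟩
  - a zero                                               ∎))
  where open ≡-Reasoning

chain : ∀ {m} → (Fin m → ℕ) → ℚ → Fin (suc m) → ℚ
chain         f q zero    = q
chain {suc m} f q (suc i) = chain (f ∘ suc) (flip (f zero) q) i

chain-step : ∀ {m} (f : Fin m → ℕ) q i → chain f q (suc i) ≡ flip (f i) (chain f q (inject₁ i))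
chain-step f q zero    = refl
chain-step f q (suc i) = chain-step (f ∘ suc) (flip (f zero) q) i

-- Starting from 1, the values are forced step by step. Only the closing step is a condition, and it
-- holds because the total number of flips is even.
even-cycle-switching : ∀ {m} (f : Fin (suc m) → ℕ) → sumℕ f % 2 ≡ 0 →
  Σ[ a ∈ (Fin (suc m) → ℚ) ] a zero ≡ 1ℚ × (∀ i → a i ≡ flip (f i) (a (cyclic-pred i)))
even-cycle-switching {m} f even = a , refl , λ { zero → sym closing ; (suc i) → chain-step (f ∘ suc) 1ℚ i }
  where
  open ≡-Reasoning
  a : Fin (suc m) → ℚ
  a = chain (f ∘ suc) 1ℚ
  closing : flip (f zero) (a (top m)) ≡ 1ℚ
  closing = begin
    flip (f zero) (a (top m))                 ≡⟨ cong (flip (f zero)) (flip-chain a (f ∘ suc) (chain-step (f ∘ suc) 1ℚ)) ⟩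
    flip (f zero) (flip (sumℕ (f ∘ suc)) 1ℚ)    ≡⟨ flip-+ (f zero) (sumℕ (f ∘ suc)) 1ℚ ⟨
    flip (sumℕ f) 1ℚ                            ≡⟨ flip-even (sumℕ f) 1ℚ even ⟩
    1ℚ                                          ∎

-- Unicyclic graphs

module Cyclic {m} (3≤g : 3 ≤ suc m) (T : Fin (suc m) → RootedTree) (M : Matching (C 3≤g T)) where
  private module T i = RootedTree (T i)
  open Graph (C 3≤g T) using (Adj; Adj-sym; Adj-irrefl)
  open Matching M
  open Switching (C 3≤g T) M

  ρ : Fin (suc m) → V (C 3≤g T)
  ρ i = i , T.root i

  ρ-≢ : ∀ {i j y} → i ≢ j → (i , y) ≢ ρ j
  ρ-≢ i≢j refl = i≢j refl

  pred≢ : ∀ i → cyclic-pred i ≢ i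
  pred≢ i e = Next-irrefl 3≤g i (subst (λ j → Next j i) e (Next-pred i))

  pred-pred≢ : ∀ i → cyclic-pred (cyclic-pred i) ≢ i
  pred-pred≢ i e = Next-asym 3≤g (Next-pred i)
    (subst (λ j → Next j (cyclic-pred i)) e (Next-pred (cyclic-pred i)))

  cyclic-edge : ∀ i → Adj (ρ (cyclic-pred i)) (ρ i)
  cyclic-edge i = cycleEdge (inj₁ (Next-pred i))

  cyclic-weight : Fin (suc m) → ℕ
  cyclic-weight i = weight (ρ (cyclic-pred i)) (ρ i)

  -- Only roots have edges that leave their tree, so a vertex matched outside its tree is the root,
  -- matched along the cycle.
  data MateView (i : Fin (suc m)) (x : T.V i) : Set where
    inside  : ∀ y → mate (i , x) ≡ (i , y) → MateView i x
    outside : ∀ k → x ≡ T.root i → CycAdj i k → mate (i , x) ≡ ρ k → MateView i x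

  mateView : ∀ i x → MateView i x
  mateView i x with mate (i , x) in e | mate-adj (i , x)
  ... | _ , y | treeEdge _          = inside y e
  ... | k , _ | cycleEdge c         = outside k refl c e

  -- The matching restricted to one tree, with the root fixed if its mate lies outside. Its fixed
  -- points decide the parity of the tree's order.
  τ : ∀ i → T.V i → T.V i
  τ i x with mateView i x
  ... | inside y _      = y
  ... | outside _ _ _ _ = x

  inside-outside : ∀ {i x y k} → mate (i , x) ≡ (i , y) → CycAdj i k → mate (i , x) ≢ ρ k
  inside-outside {i} e c e′ with refl ← trans (sym e) e′ = CycAdj-irrefl 3≤g i c

  τ-inside : ∀ {i x y} → mate (i , x) ≡ (i , y) → τ i x ≡ y
  τ-inside {i} {x} e with mateView i x
  ... | inside _ e′      with refl ← trans (sym e) e′ = refl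
  ... | outside _ _ c e′ = contradiction e′ (inside-outside e c)

  τ-outside : ∀ {i x k} → CycAdj i k → mate (i , x) ≡ ρ k → τ i x ≡ x
  τ-outside {i} {x} c e with mateView i x
  ... | inside _ e′     = contradiction e (inside-outside e′ c)
  ... | outside _ _ _ _ = refl

  τ-involutive : ∀ i x → τ i (τ i x) ≡ x
  τ-involutive i x with mateView i x
  ... | inside _ e      = τ-inside (mate-sym e)
  ... | outside _ _ c e = τ-outside c e

  inside⇒even : ∀ {i y} → mate (ρ i) ≡ (i , y) → T.order i % 2 ≡ 0
  inside⇒even {i} e = fixed-point-free⇒even (T.graph i) (τ i) (τ-involutive i) moved
    where
    moved : ∀ v → τ i v ≢ v
    moved v fixed with mateView i v
    ... | inside y e′         = Adj-irrefl (sym (trans e′ (cong (i ,_) fixed))) (mate-adj (i , v))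
    ... | outside k refl c e′ = inside-outside e c e′

  outside⇒odd : ∀ {i k} → CycAdj i k → mate (ρ i) ≡ ρ k → T.order i % 2 ≡ 1
  outside⇒odd {i} c e = one-fixed-point⇒odd (T.graph i) (τ i) (τ-involutive i)
    (T.root i) (τ-outside c e) unique
    where
    unique : ∀ v → τ i v ≡ v → v ≡ T.root i
    unique v fixed with mateView i v
    ... | inside y e′       = contradiction (mate-adj (i , v))
                                (Adj-irrefl (sym (trans e′ (cong (i ,_) fixed))))
    ... | outside _ v≡r _ _ = v≡r

  odd? : Fin (suc m) → ℕ
  odd? i = if does (T.order i % 2 ℕ.≟ 1) then 1 else 0

  -- Of the two cycle edges at a root at most one is in the matching, and one is exactly when the
  -- tree is odd. The root is taken at `cyclic-pred i` so that both edges can be named without a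
  -- successor function.
  odd?-weight : ∀ i → odd? (cyclic-pred i) ≡ cyclic-weight (cyclic-pred i) +ℕ cyclic-weight i
  odd?-weight i with mateView (cyclic-pred i) (T.root (cyclic-pred i))
  ... | inside y e = trans
    (if-no (_ ℕ.≟ 1) (λ odd → contradiction (trans (sym (inside⇒even e)) odd) λ ()))
    (sym (cong₂ _+ℕ_
      (trans (weight-sym (ρ _) (ρ (cyclic-pred i)))
             (weight-¬mate (ρ-≢ (pred≢ (cyclic-pred i) ∘ sym) ∘ trans (sym e))))
      (weight-¬mate (ρ-≢ (pred≢ i) ∘ trans (sym e)))))
  -- The mate is the root of tree i, so the edge behind is not a matching edge; in the next case the
  -- roles are exchanged.
  ... | outside k _ c@(inj₁ n) e with refl ← Next-functional n (Next-pred i) = trans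
    (if-yes (_ ℕ.≟ 1) (outside⇒odd c e))
    (sym (cong₂ _+ℕ_
      (trans (weight-sym (ρ _) (ρ (cyclic-pred i)))
             (weight-¬mate (ρ-≢ (pred-pred≢ i ∘ sym) ∘ trans (sym e))))
      (weight-mate e)))
  ... | outside k _ c@(inj₂ n) e with refl ← Next-injective n (Next-pred (cyclic-pred i)) = trans
    (if-yes (_ ℕ.≟ 1) (outside⇒odd c e))
    (sym (cong₂ _+ℕ_
      (trans (weight-sym (ρ _) (ρ (cyclic-pred i))) (weight-mate e))
      (weight-¬mate (ρ-≢ (pred-pred≢ i) ∘ trans (sym e)))))

  -- Every matching edge on the cycle is counted once from each of its two ends.
  #oddTrees≡2*weight : #oddTrees T ≡ sumℕ cyclic-weight +ℕ sumℕ cyclic-weight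
  #oddTrees≡2*weight = begin
    sumℕ odd?                                                     ≡⟨ sum-cyclic-pred odd? ⟨
    sumℕ (odd? ∘ cyclic-pred)                                     ≡⟨ ΣN.sum-cong-≗ odd?-weight ⟩
    sumℕ (λ i → cyclic-weight (cyclic-pred i) +ℕ cyclic-weight i) ≡⟨ ΣN.∑-distrib-+ (cyclic-weight ∘ cyclic-pred) cyclic-weight ⟩
    sumℕ (cyclic-weight ∘ cyclic-pred) +ℕ sumℕ cyclic-weight      ≡⟨ cong (_+ℕ sumℕ cyclic-weight) (sum-cyclic-pred cyclic-weight) ⟩
    sumℕ cyclic-weight +ℕ sumℕ cyclic-weight                      ∎
    where open ≡-Reasoning

  switched : ∀ x → (∀ i {u v} → T.Adj i u v → Good x (i , u) (i , v)) →
             (∀ i → Good x (ρ (cyclic-pred i)) (ρ i)) → Switched x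
  switched x tree cycle (treeEdge {i} e) = tree i e
  switched x tree cycle (cycleEdge {i} {j} (inj₁ n)) with refl ← Next-injective n (Next-pred j) = cycle j
  switched x tree cycle (cycleEdge {i} {j} (inj₂ n)) with refl ← Next-injective n (Next-pred i) =
    Good-sym {x} (ρ j) (ρ i) (cycle i)

  -- Values are chosen on the roots around the cycle first, and each tree is then filled in from its
  -- root.
  even⇒switching : sumℕ cyclic-weight % 2 ≡ 0 →
                   Σ[ x ∈ (V (C 3≤g T) → ℚ) ] ¬ (∀ v → x v ≡ 0ℚ) × Switched x
  even⇒switching even with c , c-zero , c-step ← even-cycle-switching cyclic-weight even =
    x , (λ z → contradiction (trans (sym c-zero) (trans (sym (x-ρ zero)) (z (ρ zero)))) λ ()) ,
    switched x x-tree λ i → trans (x-ρ i) (trans (c-step i)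
      (cong (flip (cyclic-weight i)) (sym (x-ρ (cyclic-pred i)))))
    where
    onTree : ∀ i → Σ[ y ∈ (T.V i → ℚ) ] y (T.root i) ≡ c i ×
      (∀ {u v} → T.Adj i u v → y v ≡ flip (weight (i , u) (i , v)) (y u))
    onTree i = Tree.tree-switching (T.graph i) (T.isTree i) (T.root i)
      (λ u v → weight (i , u) (i , v)) (λ u v → weight-sym (i , u) (i , v)) (c i)

    x : V (C 3≤g T) → ℚ
    x (i , v) = proj₁ (onTree i) v

    x-ρ : ∀ i → x (ρ i) ≡ c i
    x-ρ i = proj₁ (proj₂ (onTree i))

    x-tree : ∀ i {u v} → T.Adj i u v → Good x (i , u) (i , v)
    x-tree i = proj₂ (proj₂ (onTree i))

  module _ (x : V (C 3≤g T) → ℚ) (balanced : ∀ u → Balanced x u) where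

    -- At a vertex other than the root all edges are tree edges. If all but one have defect 0,
    -- balance forces the last defect to be 0 as well.
    tree-good : ∀ i {u v} → T.Adj i u v → Good x (i , u) (i , v)
    tree-good i = Tree.leaf-induction (T.graph i) (T.isTree i) (T.root i)
      (λ u v → Good x (i , u) (i , v)) (λ {u} {v} → Good-sym {x} (i , u) (i , v)) step
      where
      step : ∀ {u} → u ≢ T.root i → ∀ p →
             (∀ w → T.Adj i u w → w ≢ p → Good x (i , u) (i , w)) →
             T.Adj i u p → Good x (i , u) (i , p)
      step {u} u≢r p others e = defect≡0⇒Good x (treeEdge e)
        (Balanced-single x (i , u) (i , p) (balanced (i , u))
          λ w w≢p → Good⇒defect≡0 x (good w w≢p))
        where
        good : ∀ w → w ≢ (i , p) → Adj (i , u) w → Good x (i , u) w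
        good _ w≢p (treeEdge e′)  = others _ e′ λ { refl → w≢p refl }
        good _ _   (cycleEdge c) = contradiction refl u≢r

    cycle-defect : Fin (suc m) → ℚ
    cycle-defect i = defect x (ρ i) (ρ (cyclic-pred i))

    -- At a root all tree edges have defect 0, so the two cycle edges balance.
    cycle-defect-step : ∀ i → cycle-defect i ≡ flip (cyclic-weight i) (cycle-defect (cyclic-pred i))
    cycle-defect-step i = begin
      cycle-defect i
        ≡⟨ flip-involutive k (cycle-defect i) ⟨
      flip k (flip k (cycle-defect i))
        ≡⟨ cong (flip k) (x∙y⁻¹≈ε⇒x≈y _ _ balance) ⟨
      flip k (cycle-defect j)
        ≡⟨ cong (λ k → flip k (cycle-defect j)) (weight-sym (ρ i) (ρ j)) ⟩
      flip (cyclic-weight i) (cycle-defect j)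
        ∎
      where
      open ≡-Reasoning
      j = cyclic-pred i
      k = weight (ρ i) (ρ j)

      good : ∀ w → w ≢ ρ (cyclic-pred j) → w ≢ ρ i → Adj (ρ j) w → Good x (ρ j) w
      good _ _ _   (treeEdge e)         = tree-good j e
      good _ _ w≢i (cycleEdge (inj₁ n)) = contradiction (cong ρ (Next-functional n (Next-pred i))) w≢i
      good _ w≢ _  (cycleEdge (inj₂ n)) = contradiction (cong ρ (Next-injective n (Next-pred j))) w≢

      balance : cycle-defect j - flip k (cycle-defect i) ≡ 0ℚ
      balance = trans
        -- By `defect-antisym` the subtracted term is the defect of the same edge seen from `ρ j`,
        -- so both summands are defects at `ρ j`.
        (cong (cycle-defect j +_) (sym (defect-antisym x (Adj-sym (cyclic-edge i)))))
        (Balanced-pair x (ρ j) (ρ (cyclic-pred j)) (ρ i) (ρ-≢ (pred-pred≢ i)) (balanced (ρ j))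
          λ w w≢ w≢i → Good⇒defect≡0 x (good w w≢ w≢i))

    -- `odd-cycle-zero` is applied twice: to the defects, which gives the sign rule on the cycle,
    -- and then to the values at the roots. Tree walks carry the zeros to all other vertices.
    odd⇒zero : sumℕ cyclic-weight % 2 ≡ 1 → ∀ v → x v ≡ 0ℚ
    odd⇒zero odd (i , v) = Switched-zero x (switched x tree-good cycle-good)
      (gmap (i ,_) treeEdge (proj₂ (proj₁ (T.isTree i)) (T.root i) v))
      (odd-cycle-zero (x ∘ ρ) cyclic-weight cycle-good odd i)
      where
      cycle-good : ∀ i → Good x (ρ (cyclic-pred i)) (ρ i)
      cycle-good i = Good-sym {x} (ρ i) (ρ (cyclic-pred i))
        (defect≡0⇒Good x (Adj-sym (cyclic-edge i))
          (odd-cycle-zero cycle-defect cyclic-weight cycle-defect-step odd i))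

  4∣#oddTrees⇒even : #oddTrees T % 4 ≡ 0 → sumℕ cyclic-weight % 2 ≡ 0
  4∣#oddTrees⇒even 4∣ with %2-cases (sumℕ cyclic-weight)
  ... | inj₁ even = even
  ... | inj₂ odd  = contradiction
    (trans (sym (odd-double-%4 (sumℕ cyclic-weight) odd)) (trans (cong (_% 4) (sym #oddTrees≡2*weight)) 4∣)) λ ()

  eigenvector⇒4∣#oddTrees : ∀ x → ¬ (∀ v → x v ≡ 0ℚ) → (∀ u → Balanced x u) → #oddTrees T % 4 ≡ 0
  eigenvector⇒4∣#oddTrees x x≢0 balanced with %2-cases (sumℕ cyclic-weight)
  ... | inj₁ even = trans (cong (_% 4) #oddTrees≡2*weight) (even-double-%4 (sumℕ cyclic-weight) even)
  ... | inj₂ odd  = contradiction (odd⇒zero x balanced odd) x≢0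

-- Transport along a graph isomorphism.

module Transport {G H : Graph} (iso : G ≅ H) (M : Matching G) where
  private
    module G = Graph G
    module H = Graph H
    module M = Matching M
    module S = Switching G M
  open _≅_ iso
  open Inverse bijection using (to; from; strictlyInverseˡ; strictlyInverseʳ)

  to-injective : ∀ {u v} → to u ≡ to v → u ≡ v
  to-injective e = trans (sym (strictlyInverseʳ _)) (trans (cong from e) (strictlyInverseʳ _))

  matching-≅ : Matching H
  matching-≅ = record
    { mate            = to ∘ M.mate ∘ from
    ; mate-adj        = λ u → subst (λ v → H.Adj v (to (M.mate (from u)))) (strictlyInverseˡ u)
                                (Equivalence.to Adj-⇔ (M.mate-adj (from u)))
    ; mate-involutive = λ u → trans (cong (to ∘ M.mate) (strictlyInverseʳ (M.mate (from u))))
                                (trans (cong to (M.mate-involutive (from u))) (strictlyInverseˡ u))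
    }

  private module S′ = Switching H matching-≅

  weight-≅ : ∀ u v → S′.weight (to u) (to v) ≡ S.weight u v
  weight-≅ u v with M.mate u G.≟ⱽ v
  ... | yes e = trans (S′.weight-mate (cong to (trans (cong M.mate (strictlyInverseʳ u)) e)))
                      (sym (S.weight-mate e))
  ... | no ¬e = trans
    (S′.weight-¬mate λ e → ¬e (trans (cong M.mate (sym (strictlyInverseʳ u))) (to-injective e)))
    (sym (S.weight-¬mate ¬e))

  defect-≅ : ∀ x u v → S′.defect (x ∘ from) (to u) (to v) ≡ S.defect x u v
  defect-≅ x u v with G.Adj? u v
  ... | yes e = trans (S′.defect-edge (x ∘ from) (Equivalence.to Adj-⇔ e))
    (cong₂ _-_ (cong₂ flip (weight-≅ u v) (cong x (strictlyInverseʳ u))) (cong x (strictlyInverseʳ v)))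
  ... | no ¬e = if-no (H.Adj? (to u) (to v)) (¬e ∘ Equivalence.from Adj-⇔)

  -- The two enumerations list the vertices in different orders; composing them with the isomorphism
  -- gives the permutation that matches the sums.
  Balanced-≅ : ∀ x → (∀ u → S.Balanced x u) → ∀ u → S′.Balanced (x ∘ from) u
  Balanced-≅ x balanced u = begin
    sumℚ (S′.defect (x ∘ from) u ∘ H.vertex)
      ≡⟨ sum-permute (S′.defect (x ∘ from) u ∘ H.vertex)
           (↔-trans G.enum (↔-trans bijection (↔-sym H.enum))) ⟩
    sumℚ (λ i → S′.defect (x ∘ from) u (H.vertex (Index.index H (to (G.vertex i)))))
      ≡⟨ sum-cong-≗ (λ i → trans
           (cong₂ (S′.defect (x ∘ from)) (sym (strictlyInverseˡ u)) (Index.vertex-index H (to (G.vertex i))))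
           (defect-≅ x (from u) (G.vertex i))) ⟩
    sumℚ (S.defect x (from u) ∘ G.vertex)
      ≡⟨ balanced (from u) ⟩
    0ℚ ∎
    where open ≡-Reasoning

  -- This goes from H back to G: sign vectors are built on `C 3≤g T` but glued on the given graphs.
  Switched-≅ : ∀ y → S′.Switched y → S.Switched (y ∘ to)
  Switched-≅ y s {u} {v} e =
    trans (s (Equivalence.to Adj-⇔ e)) (cong (λ k → flip k (y (to u))) (weight-≅ u v))

-- Eigenvalue 2 and odd trees for a given unicyclic graph.

module _ {G : Graph} (M : Matching G) {m} (3≤g : 3 ≤ suc m)
         (T : Fin (suc m) → RootedTree) (iso : G ≅ C 3≤g T) where
  open Switching G M
  open Transport iso M
  open Inverse (_≅_.bijection iso) using (to; from; strictlyInverseˡ; strictlyInverseʳ)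
  private module Cyc = Cyclic 3≤g T matching-≅

  eigenvalue⇒4∣#oddTrees : HasEigenvalue (laplacian G) (fromℕ 2) → #oddTrees T % 4 ≡ 0
  eigenvalue⇒4∣#oddTrees eigen =
    let x , x≢0 , balanced = Equivalence.to HasEigenvalue⇔Balanced eigen in
    Cyc.eigenvector⇒4∣#oddTrees (x ∘ from)
      (λ z → x≢0 λ v → trans (cong x (sym (strictlyInverseʳ v))) (z (to v)))
      (Balanced-≅ x balanced)

  -- Connectedness upgrades nonzero to nowhere zero, which the rescaling at the bridge relies on.
  4∣#oddTrees⇒switching : Connected G → #oddTrees T % 4 ≡ 0 →
    Σ[ x ∈ (V G → ℚ) ] (∀ v → x v ≢ 0ℚ) × Switched x
  4∣#oddTrees⇒switching (_ , connected) 4∣ =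
    let y , y≢0 , s = Cyc.even⇒switching (Cyc.4∣#oddTrees⇒even 4∣) in
    y ∘ to ,
    (λ v yv≡0 → y≢0 λ w → trans (cong y (sym (strictlyInverseˡ w)))
      (Switched-zero (y ∘ to) (Switched-≅ y s) (connected v (from w)) yv≡0)) ,
    Switched-≅ y s

-- Gluing sign vectors along the bridge.

module Bridge (G₁ G₂ : Graph) (M₁ : Matching G₁) (M₂ : Matching G₂) (u : V G₁) (v : V G₂) where
  private
    module G₁ = Graph G₁
    module G₂ = Graph G₂
    module M₁ = Matching M₁
    module M₂ = Matching M₂
    module S₁ = Switching G₁ M₁
    module S₂ = Switching G₂ M₂

  -- The bridge is not a matching edge, so the sign rule there asks for equal values at its two
  -- ends.
  matching-⊙ : Matching (oneEdgeConnection G₁ G₂ u v)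
  matching-⊙ = record
    { mate            = ⊎.map M₁.mate M₂.mate
    ; mate-adj        = λ { (inj₁ a) → left (M₁.mate-adj a) ; (inj₂ b) → right (M₂.mate-adj b) }
    ; mate-involutive = λ { (inj₁ a) → cong inj₁ (M₁.mate-involutive a)
                          ; (inj₂ b) → cong inj₂ (M₂.mate-involutive b) }
    }

  open Switching (oneEdgeConnection G₁ G₂ u v) matching-⊙

  weight-left : ∀ a b → weight (inj₁ a) (inj₁ b) ≡ S₁.weight a b
  weight-left a b with M₁.mate a G₁.≟ⱽ b
  ... | yes e = trans (weight-mate {inj₁ a} (cong inj₁ e)) (sym (S₁.weight-mate e))
  ... | no ¬e = trans (weight-¬mate {inj₁ a} (¬e ∘ inj₁-injective)) (sym (S₁.weight-¬mate ¬e))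

  weight-right : ∀ a b → weight (inj₂ a) (inj₂ b) ≡ S₂.weight a b
  weight-right a b with M₂.mate a G₂.≟ⱽ b
  ... | yes e = trans (weight-mate {inj₂ a} (cong inj₂ e)) (sym (S₂.weight-mate e))
  ... | no ¬e = trans (weight-¬mate {inj₂ a} (¬e ∘ inj₂-injective)) (sym (S₂.weight-¬mate ¬e))

  glue : ∀ x₁ x₂ → (∀ a → x₁ a ≢ 0ℚ) → (∀ b → x₂ b ≢ 0ℚ) → S₁.Switched x₁ → S₂.Switched x₂ →
         HasEigenvalue (laplacian (oneEdgeConnection G₁ G₂ u v)) (fromℕ 2)
  glue x₁ x₂ x₁≢0 x₂≢0 s₁ s₂ = Equivalence.from HasEigenvalue⇔Balanced
    (x , (λ z → p*q≢0 (x₂≢0 v) (x₁≢0 u) (z (inj₁ u))) , Switched⇒Balanced x x-switched)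
    where
    -- The two vectors are rescaled to agree at the ends of the bridge.
    x : V G₁ ⊎ V G₂ → ℚ
    x (inj₁ a) = x₂ v * x₁ a
    x (inj₂ b) = x₁ u * x₂ b

    bridge-good : Good x (inj₁ u) (inj₂ v)
    bridge-good = trans (ℚ.*-comm (x₁ u) (x₂ v))
      (sym (cong (λ k → flip k (x (inj₁ u))) (weight-¬mate {inj₁ u} {inj₂ v} λ ())))

    x-switched : Switched x
    x-switched (left {a} {b} e) = begin
      x₂ v * x₁ b                          ≡⟨ cong (x₂ v *_) (s₁ e) ⟩
      x₂ v * flip (S₁.weight a b) (x₁ a)   ≡⟨ flip-* (S₁.weight a b) (x₂ v) (x₁ a) ⟨
      flip (S₁.weight a b) (x₂ v * x₁ a)   ≡⟨ cong (λ k → flip k (x₂ v * x₁ a)) (weight-left a b) ⟨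
      flip (weight (inj₁ a) (inj₁ b)) (x₂ v * x₁ a) ∎
      where open ≡-Reasoning
    x-switched (right {a} {b} e) = begin
      x₁ u * x₂ b                          ≡⟨ cong (x₁ u *_) (s₂ e) ⟩
      x₁ u * flip (S₂.weight a b) (x₂ a)   ≡⟨ flip-* (S₂.weight a b) (x₁ u) (x₂ a) ⟨
      flip (S₂.weight a b) (x₁ u * x₂ a)   ≡⟨ cong (λ k → flip k (x₁ u * x₂ a)) (weight-right a b) ⟨
      flip (weight (inj₂ a) (inj₂ b)) (x₁ u * x₂ a) ∎
      where open ≡-Reasoning
    x-switched bridge  = bridge-good
    x-switched bridge′ = Good-sym {x} (inj₁ u) (inj₂ v) bridge-good

-- The equivalence for one-edge connections.

theorem11 : (G₁ G₂ : Graph) → Unicyclic G₁ → Unicyclic G₂ →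
    (g₁ g₂ : ℕ) (3≤g₁ : 3 ≤ g₁) (3≤g₂ : 3 ≤ g₂)
    (T : Fin g₁ → RootedTree) (T′ : Fin g₂ → RootedTree) →
    G₁ ≅ C 3≤g₁ T → G₂ ≅ C 3≤g₂ T′ →
    HasPerfectMatching G₁ → HasPerfectMatching G₂ →
    HasEigenvalue (laplacian G₁) (fromℕ 2) →
    HasEigenvalue (laplacian G₂) (fromℕ 2) →
    (u : V G₁) (v : V G₂) →
    (#oddTrees T % 4 ≡ 0 × #oddTrees T′ % 4 ≡ 0) ⇔
    HasEigenvalue (laplacian (oneEdgeConnection G₁ G₂ u v)) (fromℕ 2)
-- Matching on `s≤s` exhibits both cycle lengths as successors, the form in which `cyclic-pred`
-- works.
theorem11 G₁ G₂ (connected₁ , _) (connected₂ , _) _ _ 3≤g₁@(s≤s _) 3≤g₂@(s≤s _) T T′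
    iso₁ iso₂ pm₁ pm₂ eigen₁ eigen₂ u v =
  mk⇔ glued λ _ → eigenvalue⇒4∣#oddTrees M₁ 3≤g₁ T iso₁ eigen₁ ,
                   eigenvalue⇒4∣#oddTrees M₂ 3≤g₂ T′ iso₂ eigen₂
  where
  M₁ = matching pm₁
  M₂ = matching pm₂
  glued : #oddTrees T % 4 ≡ 0 × #oddTrees T′ % 4 ≡ 0 →
          HasEigenvalue (laplacian (oneEdgeConnection G₁ G₂ u v)) (fromℕ 2)
  glued (4∣₁ , 4∣₂) =
    let x₁ , x₁≢0 , s₁ = 4∣#oddTrees⇒switching M₁ 3≤g₁ T iso₁ connected₁ 4∣₁
        x₂ , x₂≢0 , s₂ = 4∣#oddTrees⇒switching M₂ 3≤g₂ T′ iso₂ connected₂ 4∣₂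
    in Bridge.glue G₁ G₂ M₁ M₂ u v x₁ x₂ x₁≢0 x₂≢0 s₁ s₂
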